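{- There is an algorithm which, given a finite graph $G$, computes an R-cocore of $G$ in time polynomial in the number of vertices of $G$.
   Context: Graphs are finite and undirected, with loops allowed: $G=(V_G,E_G)$ with $E_G\subseteq V_G\times V_G$ symmetric. For a graph $G$, a finite set $B$ and a relation $R\subseteq V_G\times B$ with full image (for every $b\in B$ there is $v\in V_G$ with $(v,b)\in R$), $G\ast R$ is the graph with vertex set $B$ and edge set $\{(u,v)\in B\times B : \text{there is } (x,y)\in E_G \text{ with } (x,u),(y,v)\in R\}$. The equation $H\ast R=G$ means that $R\subseteq V_H\times V_G$ has full image and $H\ast R$ equals $G$ as a graph. Let $H$ be an induced subgraph of $G$. An R-coretraction of $H$ to $G$ is a relation $R\subseteq V_H\times V_G$ such that $H\ast R=G$ and $(x,x)\in R$ for all $x\in V_H$; if one exists, $H$ is called an R-coretract of $G$. An R-coretract $H$ of $G$ is an R-cocore of $G$ if $H$ has no proper induced subgraph that is an R-coretract of $H$. -}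

module Defs where

open import Data.Bool using (Bool; T; not; if_then_else_)
open import Data.Fin using (Fin; toℕ; fromℕ<; remQuot)
open import Data.Nat using (ℕ; suc; _+_; _*_; _∸_; _≡ᵇ_; _<?_)
open import Data.Product using (∃; _×_; _,_; proj₁; proj₂)
open import Function using (_∘_; _on_)
open import Function.Bundles using (_⇔_)
open import Level using (0ℓ)
open import Relation.Binary using (Rel; REL; Symmetric; Decidable)
open import Relation.Binary.PropositionalEquality using (_≡_; _≢_)
open import Relation.Nullary using (¬_; does; yes; no)

------------------------------------------------------------------------
-- Graphs

-- Finiteness is not a field: the graphs considered are those on Fin n,
-- and their (iterated) induced subgraphs.
record Graph (V : Set) : Set₁ where
  field
    Edge : Rel V 0ℓ
    sym  : Symmetric Edge

open Graph public using (Edge)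

-- A subset of a finite set, given by its characteristic function.
Subset : Set → Set
Subset V = V → Bool

-- T b has at most one element, so every member of S occurs exactly once.
⟦_⟧ : {V : Set} → Subset V → Set
⟦ S ⟧ = ∃ λ v → T (S v)

-- Induced subgraph.
_[_] : {V : Set} → Graph V → (S : Subset V) → Graph ⟦ S ⟧
G [ S ] = record { Edge = Edge G on proj₁ ; sym = Graph.sym G }

Proper : {V : Set} → Subset V → Set
Proper S = ∃ λ v → ¬ T (S v)

------------------------------------------------------------------------
-- R-coretracts and R-cocores

FullImage : {A B : Set} → REL A B 0ℓ → Set
FullImage R = ∀ b → ∃ λ a → R a b

_∗_ : {A B : Set} → Graph A → REL A B 0ℓ → Graph B
G ∗ R = record
  { Edge = λ u v → ∃ λ x → ∃ λ y → Edge G x y × R x u × R y v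
  ; sym  = λ { (x , y , xy , xu , yv) → y , x , Graph.sym G xy , yv , xu }
  }

-- The equation H ∗ R = G. Both sides have vertex set B by typing; the
-- requirement that R have full image is part of the equation's meaning.
_∗_≐_ : {A B : Set} → Graph A → REL A B 0ℓ → Graph B → Set
H ∗ R ≐ G = FullImage R × (∀ u v → Edge (H ∗ R) u v ⇔ Edge G u v)

IsRCoretraction : {V : Set} (G : Graph V) (S : Subset V) → REL ⟦ S ⟧ V 0ℓ → Set
IsRCoretraction G S R = ((G [ S ]) ∗ R ≐ G) × (∀ x → R x (proj₁ x))

IsRCoretract : {V : Set} → Graph V → Subset V → Set₁
IsRCoretract G S = ∃ λ R → IsRCoretraction G S R

IsRCocore : {V : Set} → Graph V → Subset V → Set₁
IsRCocore G S =
  IsRCoretract G S ×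
  ¬ (∃ λ (K : Subset ⟦ S ⟧) → Proper K × IsRCoretract (G [ S ]) K)

------------------------------------------------------------------------
-- Model of computation: structured programs for a random access machine
-- with registers and memory cells holding natural numbers. Each
-- instruction and each test takes one unit of time. The arithmetic is
-- restricted to addition and truncated subtraction, so in t steps the
-- bit length of a stored number grows by at most O(t); hence polynomial
-- time here agrees with polynomial time on Turing machines (unit-cost
-- multiplication would break this).

Reg : Set
Reg = ℕ

infixr 5 _⨾_

data Program : Set where
  skip      : Program
  const     : (x : Reg) (k : ℕ) → Program      -- x := k
  move      : (x y : Reg) → Program            -- x := y
  add       : (x y z : Reg) → Program          -- x := y + z
  sub       : (x y z : Reg) → Program          -- x := y ∸ z
  load      : (x y : Reg) → Program            -- x := mem[y]
  store     : (x y : Reg) → Program            -- mem[x] := y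
  _⨾_       : (p q : Program) → Program
  ifNonZero : (x : Reg) (p q : Program) → Program
  while     : (x : Reg) (p : Program) → Program -- while x ≠ 0 do p

record State : Set where
  constructor ⟨_,_⟩
  field
    reg : Reg → ℕ
    mem : ℕ → ℕ

open State public

_[_↦_] : (ℕ → ℕ) → ℕ → ℕ → (ℕ → ℕ)
(f [ i ↦ v ]) j = if j ≡ᵇ i then v else f j

setReg : State → Reg → ℕ → State
setReg ⟨ r , m ⟩ x v = ⟨ r [ x ↦ v ] , m ⟩

setMem : State → ℕ → ℕ → State
setMem ⟨ r , m ⟩ a v = ⟨ r , m [ a ↦ v ] ⟩

-- p , s ⇓ s′ after t : started in s, the program p halts in state s′
-- after exactly t steps. At most one rule applies to each p and s.
data _,_⇓_after_ : Program → State → State → ℕ → Set where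
  skip  : ∀ {s} → skip , s ⇓ s after 1
  const : ∀ {x k s} → const x k , s ⇓ setReg s x k after 1
  move  : ∀ {x y s} → move x y , s ⇓ setReg s x (reg s y) after 1
  add   : ∀ {x y z s} →
          add x y z , s ⇓ setReg s x (reg s y + reg s z) after 1
  sub   : ∀ {x y z s} →
          sub x y z , s ⇓ setReg s x (reg s y ∸ reg s z) after 1
  load  : ∀ {x y s} → load x y , s ⇓ setReg s x (mem s (reg s y)) after 1
  store : ∀ {x y s} → store x y , s ⇓ setMem s (reg s x) (reg s y) after 1
  seq   : ∀ {p q s s′ s″ t t′} →
          p , s ⇓ s′ after t → q , s′ ⇓ s″ after t′ →
          (p ⨾ q) , s ⇓ s″ after (t + t′)
  if-≢0 : ∀ {x p q s s′ t} → reg s x ≢ 0 →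
          p , s ⇓ s′ after t → ifNonZero x p q , s ⇓ s′ after suc t
  if-≡0 : ∀ {x p q s s′ t} → reg s x ≡ 0 →
          q , s ⇓ s′ after t → ifNonZero x p q , s ⇓ s′ after suc t
  while-≢0 : ∀ {x p s s′ s″ t t′} → reg s x ≢ 0 →
          p , s ⇓ s′ after t → while x p , s′ ⇓ s″ after t′ →
          while x p , s ⇓ s″ after suc (t + t′)
  while-≡0 : ∀ {x p s} → reg s x ≡ 0 → while x p , s ⇓ s after 1

------------------------------------------------------------------------
-- Input and output of graph algorithms

bit : Bool → ℕ
bit b = if b then 1 else 0

-- The adjacency matrix in row-major order: cell n * i + j tells whether
-- (i , j) is an edge; all cells from n * n on are 0.
matrix : ∀ {n} (G : Graph (Fin n)) → Decidable (Edge G) → ℕ → ℕ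
matrix {n} G E? a with a <? n * n
... | yes a<n² = let (i , j) = remQuot n (fromℕ< a<n²) in bit (does (E? i j))
... | no  _    = 0

-- Register 0 holds the number of vertices, the other registers hold 0.
input : ∀ {n} (G : Graph (Fin n)) → Decidable (Edge G) → State
input {n} G E? = ⟨ (λ _ → 0) [ 0 ↦ n ] , matrix G E? ⟩

-- The set of vertices computed is read off the n cells that follow the
-- n * n cells of the input matrix; nonzero means member.
output : ∀ n → State → Subset (Fin n)
output n s v = not (mem s (n * n + toℕ v) ≡ᵇ 0)

{-# OPTIONS --safe #-}

-- Write N(v) for the neighbourhood of v. A set S is an R-coretract of G
-- exactly when every N(v) is the union of a nonempty family of
-- neighbourhoods N(x) with x ∈ S. Order the vertices strictly by x ≺ v iff
-- N(x) ⊆ N(v) and, if N(x) = N(v), then x < v. The vertices v for which N(v)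
-- is not the union of a nonempty family of N(x) with x ≺ v form an R-cocore.
-- This set is defined by a fixed first-order formula in the edge relation
-- and <, and a first-order formula is evaluated in polynomial time by one
-- loop per quantifier.
module Submission where

open import Defs
open import Data.Bool using (T; not)
open import Data.Bool.Properties using (T?; T-irrelevant)
open import Data.Empty using (⊥-elim)
open import Data.Fin as Fin using (Fin; zero; suc; toℕ; fromℕ<; combine; #_)
open import Data.Fin.Induction using (spo-wellFounded)
open import Data.Fin.Properties as Fin
  using (toℕ<n; toℕ-fromℕ<; toℕ-combine; remQuot-combine; toℕ-injective)
open import Data.Nat
  using (ℕ; zero; suc; _+_; _*_; _∸_; _^_; _≤_; _<_; _≡ᵇ_; _<?_; z≤n; s≤s)
open import Data.Nat.Properties
open import Data.Product using (∃; _×_; _,_; proj₁; proj₂)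
open import Data.Sum using (inj₁; inj₂)
open import Data.Vec using (Vec; []; _∷_; lookup)
open import Function using (_∘_)
open import Function.Bundles using (mk⇔; Equivalence)
open import Induction.WellFounded using (module All; WellFounded)
open import Level using (0ℓ)
open import Relation.Binary
  using (Rel; Decidable; IsStrictPartialOrder; tri<; tri≈; tri>)
open import Relation.Binary.PropositionalEquality hiding ([_])
open import Relation.Nullary using (¬_; yes; no; does; contradiction)

-- Neighbourhoods and R-cocores

module Neighbourhoods {n : ℕ} (G : Graph (Fin n)) where

  infix 4 _~_ _⊑_ _≺_

  _~_ _⊑_ _≺_ : Rel (Fin n) 0ℓ
  _~_ = Edge G
  x ⊑ v = ∀ w → x ~ w → v ~ w
  x ≺ v = x ⊑ v × (v ⊑ x → x Fin.< v)

  ~-sym : ∀ {x y} → x ~ y → y ~ x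
  ~-sym = Graph.sym G

  -- For a vertex without neighbours the second component is vacuous; the first then stands in for
  -- the full image requirement.
  Covered : Fin n → Set
  Covered v = (∃ λ x → x ≺ v) × (∀ w → v ~ w → ∃ λ x → x ≺ v × x ~ w)

  ⊑-refl : ∀ {x} → x ⊑ x
  ⊑-refl _ e = e

  ⊑-trans : ∀ {x y z} → x ⊑ y → y ⊑ z → x ⊑ z
  ⊑-trans p q w = q w ∘ p w

  ≺-isStrictPartialOrder : IsStrictPartialOrder _≡_ _≺_
  ≺-isStrictPartialOrder = record
    { isEquivalence = isEquivalence
    ; irrefl        = λ { refl (_ , x<x) → Fin.<-irrefl refl (x<x ⊑-refl) }
    ; trans         = λ (x⊑y , x<y) (y⊑z , y<z) →
        ⊑-trans x⊑y y⊑z ,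
        λ z⊑x → Fin.<-trans (x<y (⊑-trans y⊑z z⊑x)) (y<z (⊑-trans z⊑x x⊑y))
    ; <-resp-≈      = resp₂ _≺_
    }

  ≺-wellFounded : WellFounded _≺_
  ≺-wellFounded = spo-wellFounded ≺-isStrictPartialOrder

  -- The only way to miss `x ≺ v` is N(x) = N(v) with `v < x`. But then `v ≺ x`, and `v` alone
  -- covers `x`.
  ⊑-uncovered⇒≺ : ∀ {x v} → x ≢ v → ¬ Covered x → x ⊑ v → x ≺ v
  ⊑-uncovered⇒≺ {x} {v} x≢v ¬cov x⊑v = x⊑v , λ v⊑x → below v⊑x (Fin.<-cmp x v)
    where
    below : v ⊑ x → _ → x Fin.< v
    below v⊑x (tri< x<v _ _) = x<v
    below v⊑x (tri≈ _ x≡v _) = contradiction x≡v x≢v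
    below v⊑x (tri> _ _ v<x) =
      let v≺x = v⊑x , λ _ → v<x
      in contradiction ((v , v≺x) , λ w xw → v , v≺x , x⊑v w xw) ¬cov

  -- The two hypotheses make `S` the set of uncovered vertices. They are phrased so that the output
  -- cells of a program can supply them directly.
  module _ (S : Subset (Fin n))
           (dropped : ∀ v → ¬ T (S v) → Covered v)
           (kept : ∀ v → T (S v) → ¬ Covered v) where

    -- This gives full image for the coretraction `⊑`: a dropped vertex passes the search on to a
    -- ≺-smaller vertex, and well-foundedness ends it inside `S`.
    generator : ∀ v → ∃ λ (x : ⟦ S ⟧) → proj₁ x ⊑ v
    generator = All.wfRec ≺-wellFounded _ _ step
      where
      step : ∀ v → (∀ {x} → x ≺ v → ∃ λ (y : ⟦ S ⟧) → proj₁ y ⊑ x) →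
             ∃ λ (y : ⟦ S ⟧) → proj₁ y ⊑ v
      step v rec with T? (S v)
      ... | yes v∈S = (v , v∈S) , ⊑-refl
      ... | no  v∉S =
        let (x , x≺v) , _ = dropped v v∉S
            y , y⊑x       = rec x≺v
        in y , ⊑-trans y⊑x (proj₁ x≺v)

    -- The same descent, now choosing at each stage a smaller vertex that is still adjacent to the
    -- fixed `w`.
    generator-at : ∀ v w → v ~ w → ∃ λ (x : ⟦ S ⟧) → proj₁ x ⊑ v × proj₁ x ~ w
    generator-at = All.wfRec ≺-wellFounded _ _ step
      where
      step : ∀ v →
        (∀ {x} → x ≺ v → ∀ w → x ~ w → ∃ λ (y : ⟦ S ⟧) → proj₁ y ⊑ x × proj₁ y ~ w) →
        ∀ w → v ~ w → ∃ λ (y : ⟦ S ⟧) → proj₁ y ⊑ v × proj₁ y ~ w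
      step v rec w vw with T? (S v)
      ... | yes v∈S = (v , v∈S) , ⊑-refl , vw
      ... | no  v∉S =
        let x , x≺v , xw = proj₂ (dropped v v∉S) w vw
            y , y⊑x , yw = rec x≺v w xw
        in y , ⊑-trans y⊑x (proj₁ x≺v) , yw

    isRCoretract : IsRCoretract G S
    isRCoretract =
      (λ x v → proj₁ x ⊑ v) , (generator , λ u v → mk⇔ to (from u v)) , λ _ → ⊑-refl
      where
      to : ∀ {u v} → _ → u ~ v
      to (x , y , xy , x⊑u , y⊑v) = ~-sym (y⊑v _ (~-sym (x⊑u _ xy)))

      from : ∀ u v → u ~ v → _
      -- The endpoints are replaced one at a time: `x` for `u` while `v` stays, then `y` for `v`
      -- while `x` stays.
      from u v uv =
        let x , x⊑u , xv = generator-at u v uv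
            y , y⊑v , yx = generator-at v _ (~-sym xv)
        in x , y , ~-sym yx , x⊑u , y⊑v

    -- Neighbourhoods can be compared on `S` alone: a neighbour `w` of `x` has some `y ⊑ w` in `S`
    -- adjacent to `x`, and `v ~ y` then forces `v ~ w`.
    ⊑-from-S : ∀ {x v} → (∀ (w : ⟦ S ⟧) → x ~ proj₁ w → v ~ proj₁ w) → x ⊑ v
    ⊑-from-S h w xw =
      let y , y⊑w , yx = generator-at w _ (~-sym xw)
      in ~-sym (y⊑w _ (~-sym (h y (~-sym yx))))

    -- An R-coretraction of G [ S ] to some K ∌ v would exhibit N(v) as the
    -- union of a nonempty family of N(x) with x ∈ K, and each such x is ≺ v.
    noProperRCoretract :
      ¬ (∃ λ (K : Subset ⟦ S ⟧) → Proper K × IsRCoretract (G [ S ]) K)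
    noProperRCoretract (K , ((v , v∈S) , v∉K) , R , (full , edges) , R-refl) =
      kept v v∈S (nonempty , cover)
      where
      R⇒~ : ∀ {u w} {p q : ⟦ K ⟧} → proj₁ (proj₁ p) ~ proj₁ (proj₁ q) →
            R p u → R q w → proj₁ u ~ proj₁ w
      R⇒~ {u} {w} pq Rpu Rqw =
        Equivalence.to (edges u w) (_ , _ , pq , Rpu , Rqw)

      R⇒⊑ : ∀ {p u} → R p u → proj₁ (proj₁ p) ⊑ proj₁ u
      -- Reflexivity of `R` at `q` turns the edge from `p′` to `q` into one from `p` to `q`, which
      -- `R p u` and `R q w` carry to `u` and `w`.
      R⇒⊑ {p} {u} Rpu = ⊑-from-S λ w pw →
        let p′ , q , p′q , Rp′p , Rqw = Equivalence.from (edges (proj₁ p) w) pw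
        in R⇒~ {p = p} {q = q} (R⇒~ {p = p′} {q = q} p′q Rp′p (R-refl q)) Rpu Rqw

      R⇒≺ : ∀ {p} → R p (v , v∈S) → proj₁ (proj₁ p) ≺ v
      R⇒≺ {(x , x∈S) , x∈K} Rpv = ⊑-uncovered⇒≺ x≢v (kept x x∈S) (R⇒⊑ Rpv)
        where
        x≢v : x ≢ v
        x≢v refl = v∉K (subst (λ e → T (K (x , e))) (T-irrelevant x∈S v∈S) x∈K)

      nonempty : ∃ λ x → x ≺ v
      nonempty = let p , Rpv = full (v , v∈S) in _ , R⇒≺ {p} Rpv

      cover : ∀ w → v ~ w → ∃ λ x → x ≺ v × x ~ w
      cover w vw =
        -- `w` may lie outside `S`, where `R` says nothing, so it is first replaced by some `y ⊑ w`
        -- in `S` adjacent to `v`.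
        let y , y⊑w , yv           = generator-at w v (~-sym vw)
            p , q , pq , Rpy , Rqv = Equivalence.from (edges y (v , v∈S)) yv
            yq                     = R⇒~ {p = p} {q = q} pq Rpy (R-refl q)
        in _ , R⇒≺ {q} Rqv , ~-sym (y⊑w _ yq)

    isRCocore : IsRCocore G S
    isRCocore = isRCoretract , noProperRCoretract

-- First-order formulas, with de Bruijn indices for the variables

infixr 6 _∧_
infixr 5 _⇒_

data Formula (m : ℕ) : Set where
  edge less : Fin m → Fin m → Formula m
  _∧_ _⇒_   : Formula m → Formula m → Formula m
  ex all    : Formula (suc m) → Formula m

private
  variable
    m : ℕ

⊑ᶠ ≺ᶠ : Fin m → Fin m → Formula m
⊑ᶠ x v = all (edge (suc x) zero ⇒ edge (suc v) zero)
≺ᶠ x v = ⊑ᶠ x v ∧ (⊑ᶠ v x ⇒ less x v)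

-- Satisfaction of this formula at `v` unfolds to `Covered v` by computation, so no translation
-- between the two is needed.
coveredᶠ : Formula 1
coveredᶠ =
  ex (≺ᶠ (# 0) (# 1)) ∧
  all (edge (# 1) (# 0) ⇒ ex (≺ᶠ (# 0) (# 2) ∧ edge (# 0) (# 1)))

-- Total correctness with a time bound

-- The exact step count depends on the branches taken, hence on the graph; an upper bound can be
-- composed along the program text.
record Runs (p : Program) (s : State) (bound : ℕ) (Q : State → Set) : Set where
  constructor runs
  field
    {final} : State
    {steps} : ℕ
    halts   : p , s ⇓ final after steps
    bounded : steps ≤ bound
    post    : Q final

private
  variable
    p q : Program
    s s′ : State
    a b : ℕ
    P Q : State → Set

infixr 4 _▸_

_▸_ : p , s ⇓ s′ after 1 → Runs q s′ b Q → Runs (p ⨾ q) s (suc b) Q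
e ▸ runs d t≤b r = runs (seq e d) (s≤s t≤b) r

runs-seq : Runs p s a P → (∀ {s′} → P s′ → Runs q s′ b Q) → Runs (p ⨾ q) s (a + b) Q
runs-seq (runs d t≤a r) k with k r
... | runs d′ t′≤b r′ = runs (seq d d′) (+-mono-≤ t≤a t′≤b) r′

runs-weaken : a ≤ b → Runs p s a Q → Runs p s b Q
runs-weaken a≤b (runs d t≤a r) = runs d (≤-trans t≤a a≤b) r

runs-map : (∀ {s′} → P s′ → Q s′) → Runs p s b P → Runs p s b Q
runs-map f (runs d t≤b r) = runs d t≤b (f r)

runs-if-≢0 : ∀ {x} → reg s x ≢ 0 → Runs p s b Q → Runs (ifNonZero x p q) s (suc b) Q
runs-if-≢0 x≢0 (runs d t≤b r) = runs (if-≢0 x≢0 d) (s≤s t≤b) r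

runs-if-≡0 : ∀ {x} → reg s x ≡ 0 → Runs q s b Q → Runs (ifNonZero x p q) s (suc b) Q
runs-if-≡0 x≡0 (runs d t≤b r) = runs (if-≡0 x≡0 d) (s≤s t≤b) r

-- Induction on the counter: every round costs the body plus one test, and the last, failing test
-- gives the final 1.
runs-while : ∀ {x} (I : ℕ → State → Set) →
  (∀ {c s} → I c s → reg s x ≡ c) →
  (∀ {c s} → I (suc c) s → Runs p s b (I c)) →
  ∀ c → I c s → Runs (while x p) s (c * suc b + 1) (I 0)
runs-while I counter body zero i = runs (while-≡0 (counter i)) ≤-refl i
runs-while {b = b} I counter body (suc c) i with body i
... | runs {steps = t} d t≤b r with runs-while I counter body c r
...   | runs {steps = t′} d′ t′≤ r′ =
  runs (while-≢0 (λ e → 1+n≢0 (trans (sym (counter i)) e)) d d′)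
    (s≤s (≤-trans (+-mono-≤ t≤b t′≤) (≤-reflexive (sym (+-assoc b (c * suc b) 1)))))
    r′

-- Polynomial bounds

-- The base is `suc n` so that powers grow with the exponent even at `n = 0`, which sums of bounds
-- rely on.
Poly : (ℕ → ℕ) → Set
Poly f = ∃ λ c → ∃ λ k → ∀ n → f n ≤ c * suc n ^ k

poly-const : ∀ c → Poly (λ _ → c)
poly-const c = c , 0 , λ _ → ≤-reflexive (sym (*-identityʳ c))

poly-+ : ∀ {f g} → Poly f → Poly g → Poly (λ n → f n + g n)
poly-+ {f} {g} (c , k , f≤) (d , l , g≤) = c + d , k + l , λ n → begin
  f n + g n                                  ≤⟨ +-mono-≤ (f≤ n) (g≤ n) ⟩
  c * suc n ^ k + d * suc n ^ l              ≤⟨ +-mono-≤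
    (*-monoʳ-≤ c (^-monoʳ-≤ (suc n) (m≤m+n k l)))
    (*-monoʳ-≤ d (^-monoʳ-≤ (suc n) (m≤n+m l k))) ⟩
  c * suc n ^ (k + l) + d * suc n ^ (k + l)  ≡⟨ *-distribʳ-+ (suc n ^ (k + l)) c d ⟨
  (c + d) * suc n ^ (k + l)                  ∎
  where open ≤-Reasoning

poly-n* : ∀ {f} → Poly f → Poly (λ n → n * f n)
poly-n* {f} (c , k , f≤) = c , suc k , λ n → begin
  n * f n                  ≤⟨ *-mono-≤ (n≤1+n n) (f≤ n) ⟩
  suc n * (c * suc n ^ k)  ≡⟨ *-assoc (suc n) c (suc n ^ k) ⟨
  suc n * c * suc n ^ k    ≡⟨ cong (_* suc n ^ k) (*-comm (suc n) c) ⟩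
  c * suc n * suc n ^ k    ≡⟨ *-assoc c (suc n) (suc n ^ k) ⟩
  c * suc n ^ suc k        ∎
  where open ≤-Reasoning

^-distribʳ-* : ∀ m n k → (m * n) ^ k ≡ m ^ k * n ^ k
^-distribʳ-* m n zero    = refl
^-distribʳ-* m n (suc k) = trans
  (cong (m * n *_) (^-distribʳ-* m n k)) ([m*n]*[o*p]≡[m*o]*[n*p] m n (m ^ k) (n ^ k))

-- For positive `n` the reason is `suc n ≤ 2 * n`; at `n = 0` the additive `2 ^ k` takes over.
[1+n]^k≤2^k*n^k+2^k : ∀ n k → suc n ^ k ≤ 2 ^ k * n ^ k + 2 ^ k
[1+n]^k≤2^k*n^k+2^k zero k = begin
  1 ^ k                  ≤⟨ ^-monoˡ-≤ k (s≤s z≤n) ⟩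
  2 ^ k                  ≤⟨ m≤n+m (2 ^ k) _ ⟩
  2 ^ k * 0 ^ k + 2 ^ k  ∎
  where open ≤-Reasoning
[1+n]^k≤2^k*n^k+2^k n@(suc n-1) k = begin
  suc n ^ k              ≤⟨ ^-monoˡ-≤ k (+-mono-≤ (s≤s z≤n) (m≤m+n n 0)) ⟩
  (2 * n) ^ k            ≡⟨ ^-distribʳ-* 2 n k ⟩
  2 ^ k * n ^ k          ≤⟨ m≤m+n _ (2 ^ k) ⟩
  2 ^ k * n ^ k + 2 ^ k  ∎
  where open ≤-Reasoning

poly⇒≤c*n^k+c : ∀ {f} → Poly f → ∃ λ c → ∃ λ k → ∀ n → f n ≤ c * n ^ k + c
poly⇒≤c*n^k+c {f} (c , k , f≤) = c * 2 ^ k , k , λ n → begin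
  f n                              ≤⟨ f≤ n ⟩
  c * suc n ^ k                    ≤⟨ *-monoʳ-≤ c ([1+n]^k≤2^k*n^k+2^k n k) ⟩
  c * (2 ^ k * n ^ k + 2 ^ k)      ≡⟨ *-distribˡ-+ c (2 ^ k * n ^ k) (2 ^ k) ⟩
  c * (2 ^ k * n ^ k) + c * 2 ^ k  ≡⟨ cong (_+ c * 2 ^ k) (*-assoc c (2 ^ k) (n ^ k)) ⟨
  c * 2 ^ k * n ^ k + c * 2 ^ k    ∎
  where open ≤-Reasoning

-- Compilation of formulas

pattern size   = 0
pattern one    = 1
pattern area   = 2
pattern result = 3

-- A vertex x bound at quantifier depth m is kept in two registers, as x and
-- as the address n * x of its row in the matrix.
col row : ℕ → Reg
col m = 4 + m * 2
row m = 5 + m * 2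

-- The de Bruijn level is unchanged under further quantifiers, so an outer vertex keeps its
-- registers.
level : Fin m → ℕ
level {suc m} zero    = m
level {suc m} (suc i) = level i

-- Without multiplication, the row address starts at n * n and drops by n along with the vertex.
-- Both drop before `p` runs, so `p` sees the vertices from n - 1 down to 0.
forEach : ℕ → Program → Program
forEach m p =
  move (col m) size ⨾ move (row m) area ⨾
  while (col m) (sub (col m) (col m) one ⨾ sub (row m) (row m) size ⨾ p)

-- The truth value ends in `result`, nonzero meaning true. In a quantifier loop `result` is also the
-- accumulator: once it settles the answer, the remaining rounds skip the body.
compile : Formula m → Program
compile (edge i j) = add result (row (level i)) (col (level j)) ⨾ load result result
compile (less i j) = sub result (col (level j)) (col (level i))
compile (φ ∧ ψ)    = compile φ ⨾ ifNonZero result (compile ψ) skip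
compile (φ ⇒ ψ)    = compile φ ⨾ ifNonZero result (compile ψ) (const result 1)
compile {m} (ex φ)  =
  const result 0 ⨾ forEach m (ifNonZero result skip (compile φ))
compile {m} (all φ) =
  const result 1 ⨾ forEach m (ifNonZero result (compile φ) skip)

-- Two initial moves; in each round a test, two subtractions and the body; one failing test.
forEachTime : ℕ → ℕ → ℕ
forEachTime b n = 2 + (n * (3 + b) + 1)

time : Formula m → ℕ → ℕ
time (edge i j) n = 2
time (less i j) n = 1
time (φ ∧ ψ)    n = time φ n + (2 + time ψ n)
time (φ ⇒ ψ)    n = time φ n + (2 + time ψ n)
time (ex φ)     n = 1 + forEachTime (2 + time φ n) n
time (all φ)    n = 1 + forEachTime (2 + time φ n) n

poly-forEachTime : ∀ {f} → Poly f → Poly (λ n → forEachTime (f n) n)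
poly-forEachTime f-poly =
  poly-+ (poly-const 2) (poly-+ (poly-n* (poly-+ (poly-const 3) f-poly)) (poly-const 1))

time-poly : (φ : Formula m) → Poly (time φ)
time-poly (edge i j) = poly-const 2
time-poly (less i j) = poly-const 1
time-poly (φ ∧ ψ)    = poly-+ (time-poly φ) (poly-+ (poly-const 2) (time-poly ψ))
time-poly (φ ⇒ ψ)    = poly-+ (time-poly φ) (poly-+ (poly-const 2) (time-poly ψ))
time-poly (ex φ)     =
  poly-+ (poly-const 1) (poly-forEachTime (poly-+ (poly-const 2) (time-poly φ)))
time-poly (all φ)    =
  poly-+ (poly-const 1) (poly-forEachTime (poly-+ (poly-const 2) (time-poly φ)))

-- Correctness of the compiled programs

update-same : ∀ (f : ℕ → ℕ) i v → (f [ i ↦ v ]) i ≡ v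
update-same f zero    v = refl
update-same f (suc i) v = update-same (f ∘ suc) i v

update-other : ∀ (f : ℕ → ℕ) {i j} v → j ≢ i → (f [ i ↦ v ]) j ≡ f j
update-other f {zero}  {zero}  v j≢i = contradiction refl j≢i
update-other f {zero}  {suc j} v j≢i = refl
update-other f {suc i} {zero}  v j≢i = refl
update-other f {suc i} {suc j} v j≢i = update-other (f ∘ suc) v (j≢i ∘ cong suc)

level<m : (i : Fin m) → level i < m
level<m {suc m} zero    = ≤-refl
level<m {suc m} (suc i) = m<n⇒m<1+n (level<m i)

-- Each constructor carries evidence, so a flag also decides `P`; formulas are thus decided by
-- running their programs.
data Flag (P : Set) (v : ℕ) : Set where
  holds : v ≢ 0 → P → Flag P v
  fails : v ≡ 0 → ¬ P → Flag P v

flag-map : ∀ {A B v} → (A → B) → (B → A) → Flag A v → Flag B v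
flag-map to from (holds v≢0 a)  = holds v≢0 (to a)
flag-map to from (fails v≡0 ¬a) = fails v≡0 (¬a ∘ from)

module Correctness {n : ℕ} (G : Graph (Fin n)) (E? : Decidable (Edge G)) where

  infix 4 _⊨_

  _⊨_ : Vec (Fin n) m → Formula m → Set
  ρ ⊨ edge i j = Edge G (lookup ρ i) (lookup ρ j)
  ρ ⊨ less i j = lookup ρ i Fin.< lookup ρ j
  ρ ⊨ φ ∧ ψ    = (ρ ⊨ φ) × (ρ ⊨ ψ)
  ρ ⊨ φ ⇒ ψ    = ρ ⊨ φ → ρ ⊨ ψ
  ρ ⊨ ex φ     = ∃ λ x → x ∷ ρ ⊨ φ
  ρ ⊨ all φ    = ∀ x → x ∷ ρ ⊨ φ

  Adjacency : (ℕ → ℕ) → Set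
  Adjacency M = ∀ i j → M (n * toℕ i + toℕ j) ≡ bit (does (E? i j))

  record Ready (ρ : Vec (Fin n) m) (s : State) : Set where
    field
      size-reg  : reg s size ≡ n
      one-reg   : reg s one ≡ 1
      area-reg  : reg s area ≡ n * n
      col-reg   : ∀ i → reg s (col (level i)) ≡ toℕ (lookup ρ i)
      row-reg   : ∀ i → reg s (row (level i)) ≡ n * toℕ (lookup ρ i)
      adjacency : Adjacency (mem s)

  open Ready

  ready-result : ∀ {ρ : Vec (Fin n) m} {s v} → Ready ρ s → Ready ρ (setReg s result v)
  ready-result r = record
    { size-reg  = size-reg r
    ; one-reg   = one-reg r
    ; area-reg  = area-reg r
    ; col-reg   = col-reg r
    ; row-reg   = row-reg r
    ; adjacency = adjacency r
    }

  -- The bound vertices occupy registers below `4 + m * 2`, and the three constants lie below 4.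
  ready-fresh : ∀ {ρ : Vec (Fin n) m} {s a v} → m * 2 ≤ a →
                Ready ρ s → Ready ρ (setReg s (4 + a) v)
  ready-fresh {s = s} {v = v} m*2≤a r = record
    { size-reg  = size-reg r
    ; one-reg   = one-reg r
    ; area-reg  = area-reg r
    ; col-reg   = λ i → trans
        (update-other (reg s ∘ (4 +_)) v (<⇒≢ (<-trans ≤-refl (row<a i)))) (col-reg r i)
    ; row-reg   = λ i → trans
        (update-other (reg s ∘ (4 +_)) v (<⇒≢ (row<a i))) (row-reg r i)
    ; adjacency = adjacency r
    }
    where
    row<a : ∀ i → 1 + level i * 2 < _
    row<a i = ≤-trans (*-monoˡ-≤ 2 (level<m i)) m*2≤a

  ready-extend : ∀ {ρ : Vec (Fin n) m} {s} x → Ready ρ s →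
    reg s (col m) ≡ toℕ x → reg s (row m) ≡ n * toℕ x → Ready (x ∷ ρ) s
  ready-extend x r c≡ r≡ = record
    { size-reg  = size-reg r
    ; one-reg   = one-reg r
    ; area-reg  = area-reg r
    ; col-reg   = λ { zero → c≡ ; (suc i) → col-reg r i }
    ; row-reg   = λ { zero → r≡ ; (suc i) → row-reg r i }
    ; adjacency = adjacency r
    }

  ready-tail : ∀ {ρ : Vec (Fin n) m} {s x} → Ready (x ∷ ρ) s → Ready ρ s
  ready-tail r = record
    { size-reg  = size-reg r
    ; one-reg   = one-reg r
    ; area-reg  = area-reg r
    ; col-reg   = col-reg r ∘ suc
    ; row-reg   = row-reg r ∘ suc
    ; adjacency = adjacency r
    }

  -- The loop counts down: I c v M is the invariant, on the result register
  -- and the memory, once all vertices ≥ c have been visited.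
  runs-forEach : ∀ {ρ : Vec (Fin n) m} {p b s} (I : ℕ → ℕ → (ℕ → ℕ) → Set) →
    (∀ x {s} → Ready (x ∷ ρ) s → I (suc (toℕ x)) (reg s result) (mem s) →
      Runs p s b (λ s′ → Ready (x ∷ ρ) s′ × I (toℕ x) (reg s′ result) (mem s′))) →
    Ready ρ s → I n (reg s result) (mem s) →
    Runs (forEach m p) s (forEachTime b n)
      (λ s′ → Ready ρ s′ × I 0 (reg s′ result) (mem s′))
  runs-forEach {m} {ρ} {p} {b} {s₀} I body r i =
    move ▸ move ▸ runs-map (λ l → ready-here l , inv l)
      (runs-while Loop counter step n start)
    where
    record Loop (c : ℕ) (s : State) : Set where
      field
        counter    : reg s (col m) ≡ c
        offset     : reg s (row m) ≡ n * c
        in-range   : c ≤ n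
        ready-here : Ready ρ s
        inv        : I c (reg s result) (mem s)
    open Loop

    ready-set : ∀ {s v w} → Ready ρ s → Ready ρ (setReg (setReg s (col m) v) (row m) w)
    ready-set r = ready-fresh (n≤1+n _) (ready-fresh ≤-refl r)

    col-set : ∀ {v w} s → reg (setReg (setReg s (col m) v) (row m) w) (col m) ≡ v
    col-set {v} {w} s = trans
      (update-other (reg (setReg s (col m) v)) w (<⇒≢ (n<1+n (col m))))
      (update-same (reg s) (col m) v)

    row-set : ∀ {v w} s → reg (setReg (setReg s (col m) v) (row m) w) (row m) ≡ w
    row-set {v} {w} s = update-same (reg (setReg s (col m) v)) (row m) w

    start : Loop n (setReg (setReg s₀ (col m) (reg s₀ size)) (row m) (reg s₀ area))
    start = record
      { counter    = trans (col-set s₀) (size-reg r)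
      ; offset     = trans (row-set s₀) (area-reg r)
      ; in-range   = ≤-refl
      ; ready-here = ready-set r
      ; inv        = i
      }

    step : ∀ {c s} → Loop (suc c) s →
      Runs (sub (col m) (col m) one ⨾ sub (row m) (row m) size ⨾ p) s (2 + b) (Loop c)
    step {c} {s} l =
      sub ▸ sub ▸ runs-map
        (λ (r′ , i′) → record
          { counter    = trans (col-reg r′ zero) x≡c
          ; offset     = trans (row-reg r′ zero) (cong (n *_) x≡c)
          ; in-range   = <⇒≤ (in-range l)
          ; ready-here = ready-tail r′
          ; inv        = subst (λ c → I c _ _) x≡c i′
          })
        (body x (ready-extend x (ready-set (ready-here l)) col≡ row≡)
          (subst (λ c → I (suc c) _ _) (sym x≡c) (inv l)))
      where
      x = fromℕ< (in-range l)

      x≡c : toℕ x ≡ c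
      x≡c = toℕ-fromℕ< (in-range l)

      s₁ : State
      s₁ = setReg s (col m) (reg s (col m) ∸ reg s one)

      col≡ : reg (setReg s₁ (row m) (reg s₁ (row m) ∸ reg s₁ size)) (col m) ≡ toℕ x
      col≡ = trans (col-set s) (trans
        (cong₂ _∸_ (counter l) (one-reg (ready-here l))) (sym x≡c))

      row≡ : reg (setReg s₁ (row m) (reg s₁ (row m) ∸ reg s₁ size)) (row m) ≡ n * toℕ x
      row≡ = begin
        _                            ≡⟨ row-set s ⟩
        reg s₁ (row m) ∸ reg s size  ≡⟨ cong (_∸ reg s size)
          (update-other (reg s) _ (>⇒≢ (n<1+n (col m)))) ⟩
        reg s (row m) ∸ reg s size   ≡⟨ cong₂ _∸_ (offset l) (size-reg (ready-here l)) ⟩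
        n * suc c ∸ n                ≡⟨ cong (_∸ n) (*-suc n c) ⟩
        n + n * c ∸ n                ≡⟨ m+n∸m≡n n (n * c) ⟩
        n * c                        ≡⟨ cong (n *_) x≡c ⟨
        n * toℕ x                    ∎
        where open ≡-Reasoning

  -- The step of a downward loop: the vertex just handled joins those already visited.
  ∀-≥ : ∀ {P : Fin n → Set} {x} → P x → (∀ y → toℕ x < toℕ y → P y) →
        ∀ y → toℕ x ≤ toℕ y → P y
  ∀-≥ {P} px h y x≤y with m≤n⇒m<n∨m≡n x≤y
  ... | inj₁ x<y = h y x<y
  ... | inj₂ x≡y = subst P (toℕ-injective x≡y) px

  -- Unchanged memory protects both the adjacency matrix and the output cells written in earlier
  -- rounds.
  record Decided (ρ : Vec (Fin n) m) (P : Set) (M : ℕ → ℕ) (s : State) : Set where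
    constructor decided
    field
      ready     : Ready ρ s
      unchanged : mem s ≡ M
      flag      : Flag P (reg s result)

  decided-map : ∀ {ρ : Vec (Fin n) m} {A B M s} → (A → B) → (B → A) →
                Decided ρ A M s → Decided ρ B M s
  decided-map to from (decided r u f) = decided r u (flag-map to from f)

  compile-correct : ∀ (φ : Formula m) {ρ s} → Ready ρ s →
                    Runs (compile φ) s (time φ n) (Decided ρ (ρ ⊨ φ) (mem s))
  compile-correct (edge i j) {ρ} {s} r =
    add ▸ runs load ≤-refl (decided (ready-result (ready-result r)) refl flag)
    where
    entry : mem s (reg s (row (level i)) + reg s (col (level j))) ≡
            bit (does (E? (lookup ρ i) (lookup ρ j)))
    entry = trans (cong (mem s) (cong₂ _+_ (row-reg r i) (col-reg r j)))
                  (adjacency r (lookup ρ i) (lookup ρ j))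

    flag : Flag (ρ ⊨ edge i j) (mem s (reg s (row (level i)) + reg s (col (level j))))
    flag with E? (lookup ρ i) (lookup ρ j) | entry
    ... | yes e | eq = holds (λ z → 1+n≢0 (trans (sym eq) z)) e
    ... | no ¬e | eq = fails eq ¬e
  compile-correct (less i j) {ρ} {s} r =
    runs sub ≤-refl (decided (ready-result r) refl
      (subst (Flag _) (sym (cong₂ _∸_ (col-reg r j) (col-reg r i))) flag))
    where
    flag : Flag (ρ ⊨ less i j) (toℕ (lookup ρ j) ∸ toℕ (lookup ρ i))
    flag with toℕ (lookup ρ i) <? toℕ (lookup ρ j)
    ... | yes i<j = holds (m>n⇒m∸n≢0 i<j) i<j
    ... | no  i≮j = fails (m≤n⇒m∸n≡0 (≮⇒≥ i≮j)) i≮j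
  compile-correct (φ ∧ ψ) {ρ} {s} r = runs-seq (compile-correct φ r) branch
    where
    branch : ∀ {s′} → Decided ρ (ρ ⊨ φ) (mem s) s′ →
             Runs (ifNonZero result (compile ψ) skip) s′ (2 + time ψ n)
               (Decided ρ (ρ ⊨ φ ∧ ψ) (mem s))
    branch (decided r′ refl (holds v≢0 a)) =
      runs-if-≢0 v≢0 (runs-weaken (n≤1+n _)
        (runs-map (decided-map (a ,_) proj₂) (compile-correct ψ r′)))
    branch (decided r′ refl (fails v≡0 ¬a)) =
      runs-if-≡0 v≡0 (runs skip (s≤s z≤n) (decided r′ refl (fails v≡0 (¬a ∘ proj₁))))
  compile-correct (φ ⇒ ψ) {ρ} {s} r = runs-seq (compile-correct φ r) branch
    where
    branch : ∀ {s′} → Decided ρ (ρ ⊨ φ) (mem s) s′ →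
             Runs (ifNonZero result (compile ψ) (const result 1)) s′ (2 + time ψ n)
               (Decided ρ (ρ ⊨ φ ⇒ ψ) (mem s))
    branch (decided r′ refl (holds v≢0 a)) =
      runs-if-≢0 v≢0 (runs-weaken (n≤1+n _)
        (runs-map (decided-map (λ b _ → b) (λ f → f a)) (compile-correct ψ r′)))
    branch (decided r′ refl (fails v≡0 ¬a)) =
      runs-if-≡0 v≡0 (runs const (s≤s z≤n)
        (decided (ready-result r′) refl (holds (λ ()) (⊥-elim ∘ ¬a))))
  compile-correct (ex φ) {ρ} {s} r =
    const ▸ runs-map
      (λ { (r′ , u , f) →
        decided r′ u (flag-map (λ (y , _ , p) → y , p) (λ (y , p) → y , z≤n , p) f) })
      (runs-forEach I body (ready-result r)
        (refl , fails refl (λ (y , n≤y , _) → <⇒≱ (toℕ<n y) n≤y)))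
    where
    Found : ℕ → Set
    Found c = ∃ λ y → c ≤ toℕ y × y ∷ ρ ⊨ φ

    I : ℕ → ℕ → (ℕ → ℕ) → Set
    I c v M = M ≡ mem s × Flag (Found c) v

    body : ∀ x {s′} → Ready (x ∷ ρ) s′ → I (suc (toℕ x)) (reg s′ result) (mem s′) →
      Runs (ifNonZero result skip (compile φ)) s′ (2 + time φ n)
        (λ s″ → Ready (x ∷ ρ) s″ × I (toℕ x) (reg s″ result) (mem s″))
    body x r′ (u , holds v≢0 (y , x<y , p)) =
      runs-if-≢0 v≢0 (runs skip (s≤s z≤n) (r′ , u , holds v≢0 (y , <⇒≤ x<y , p)))
    body x r′ (u , fails v≡0 ¬later) =
      runs-if-≡0 v≡0 (runs-weaken (n≤1+n _) (runs-map
        (λ (decided r″ u′ f) → r″ , trans u′ u , flag-map (λ p → x , ≤-refl , p) here f)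
        (compile-correct φ r′)))
      where
      here : Found (toℕ x) → x ∷ ρ ⊨ φ
      here (y , x≤y , p) with m≤n⇒m<n∨m≡n x≤y
      ... | inj₁ x<y = contradiction (y , x<y , p) ¬later
      ... | inj₂ x≡y = subst (λ y → y ∷ ρ ⊨ φ) (sym (toℕ-injective x≡y)) p
  compile-correct (all φ) {ρ} {s} r =
    const ▸ runs-map
      (λ { (r′ , u , f) → decided r′ u (flag-map (λ h y → h y z≤n) (λ h y _ → h y) f) })
      (runs-forEach I body (ready-result r)
        (refl , holds (λ ()) (λ y n≤y → contradiction n≤y (<⇒≱ (toℕ<n y)))))
    where
    AllFrom : ℕ → Set
    AllFrom c = ∀ y → c ≤ toℕ y → y ∷ ρ ⊨ φ

    I : ℕ → ℕ → (ℕ → ℕ) → Set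
    I c v M = M ≡ mem s × Flag (AllFrom c) v

    body : ∀ x {s′} → Ready (x ∷ ρ) s′ → I (suc (toℕ x)) (reg s′ result) (mem s′) →
      Runs (ifNonZero result (compile φ) skip) s′ (2 + time φ n)
        (λ s″ → Ready (x ∷ ρ) s″ × I (toℕ x) (reg s″ result) (mem s″))
    body x r′ (u , holds v≢0 later) =
      runs-if-≢0 v≢0 (runs-weaken (n≤1+n _) (runs-map
        (λ (decided r″ u′ f) →
          r″ , trans u′ u , flag-map (λ p → ∀-≥ p later) (λ h → h x ≤-refl) f)
        (compile-correct φ r′)))
    body x r′ (u , fails v≡0 ¬later) =
      runs-if-≡0 v≡0 (runs skip (s≤s z≤n)
        (r′ , u , fails v≡0 (λ h → ¬later (λ y x<y → h y (<⇒≤ x<y)))))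

-- Computing the complement of a definable set

-- Squaring by n additions. The result is the starting row address of every loop and the first
-- output cell.
computeArea : Program
computeArea =
  move (col 0) size ⨾ while (col 0) (sub (col 0) (col 0) one ⨾ add area area size)

storeComplement : Formula 1 → Program
storeComplement φ =
  -- `result` may exceed 1, since `less` leaves a difference there; truncated subtraction from 1
  -- negates it all the same. Once `φ` is evaluated, `col 1` is free to hold the address.
  compile φ ⨾ sub result one result ⨾ add (col 1) area (col 0) ⨾ store (col 1) result

complement : Formula 1 → Program
complement φ = const one 1 ⨾ computeArea ⨾ forEach 0 (storeComplement φ)

complementTime : Formula 1 → ℕ → ℕ
complementTime φ n = 1 + (suc (n * 3 + 1) + forEachTime (time φ n + 3) n)

complementTime-poly : ∀ φ → Poly (complementTime φ)
complementTime-poly φ =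
  poly-+ (poly-const 1) (poly-+
    (poly-+ (poly-const 1) (poly-+ (poly-n* (poly-const 3)) (poly-const 1)))
    (poly-forEachTime (poly-+ (time-poly φ) (poly-const 3))))

n*i+j<n*n : ∀ {n} (i j : Fin n) → n * toℕ i + toℕ j < n * n
n*i+j<n*n i j = subst (_< _) (toℕ-combine i j) (toℕ<n (combine i j))

module ComplementCorrect {n : ℕ} (G : Graph (Fin n)) (E? : Decidable (Edge G)) where

  open Correctness G E?
  open Ready

  matrix-adjacency : Adjacency (matrix G E?)
  matrix-adjacency i j with n * toℕ i + toℕ j <? n * n
  ... | no  ≮   = contradiction (n*i+j<n*n i j) ≮
  ... | yes lt  = cong (λ (i , j) → bit (does (E? i j))) (trans
    (cong (Fin.remQuot n)
      (toℕ-injective (trans (toℕ-fromℕ< lt) (sym (toℕ-combine i j)))))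
    (remQuot-combine i j))

  ready-store : ∀ {ρ : Vec (Fin n) m} {s} x {v} →
                Ready ρ s → Ready ρ (setMem s (n * n + x) v)
  ready-store {s = s} x {v} r = record
    { size-reg  = size-reg r
    ; one-reg   = one-reg r
    ; area-reg  = area-reg r
    ; col-reg   = col-reg r
    ; row-reg   = row-reg r
    ; adjacency = λ i j → trans
        (update-other (mem s) v (<⇒≢ (≤-trans (n*i+j<n*n i j) (m≤m+n (n * n) x))))
        (adjacency r i j)
    }

  computeArea-correct : ∀ {s} →
    reg s size ≡ n → reg s one ≡ 1 → reg s area ≡ 0 → Adjacency (mem s) →
    Runs computeArea s (suc (n * 3 + 1)) (Ready [])
  computeArea-correct size≡ one≡ area≡ adj =
    move ▸ runs-map
      (λ {s′} l → record
        { size-reg  = Loop.size-inv l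
        ; one-reg   = Loop.one-inv l
        ; area-reg  = trans
            (sym (trans (cong (reg s′ area +_) (*-zeroʳ n)) (+-identityʳ (reg s′ area))))
            (Loop.area-inv l)
        ; col-reg   = λ ()
        ; row-reg   = λ ()
        ; adjacency = Loop.adj-inv l
        })
      (runs-while Loop Loop.counter step n record
        { counter  = size≡
        ; size-inv = size≡
        ; one-inv  = one≡
        ; area-inv = cong (_+ n * n) area≡
        ; adj-inv  = adj
        })
    where
    record Loop (c : ℕ) (s : State) : Set where
      field
        counter  : reg s (col 0) ≡ c
        size-inv : reg s size ≡ n
        one-inv  : reg s one ≡ 1
        area-inv : reg s area + n * c ≡ n * n
        adj-inv  : Adjacency (mem s)

    step : ∀ {c s} → Loop (suc c) s →
      Runs (sub (col 0) (col 0) one ⨾ add area area size) s 2 (Loop c)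
    step {c} {s} l = sub ▸ runs add ≤-refl record
      { counter  = cong₂ _∸_ (Loop.counter l) (Loop.one-inv l)
      ; size-inv = Loop.size-inv l
      ; one-inv  = Loop.one-inv l
      ; area-inv = begin
          reg s area + reg s size + n * c  ≡⟨ cong (λ k → reg s area + k + n * c)
            (Loop.size-inv l) ⟩
          reg s area + n + n * c           ≡⟨ +-assoc (reg s area) n (n * c) ⟩
          reg s area + (n + n * c)         ≡⟨ cong (reg s area +_) (*-suc n c) ⟨
          reg s area + n * suc c           ≡⟨ Loop.area-inv l ⟩
          n * n                            ∎
      ; adj-inv  = Loop.adj-inv l
      }
      where open ≡-Reasoning

  -- With `coveredᶠ` for the formula, the two halves become the hypotheses `dropped` and `kept`.
  Rejects : Set → ℕ → Set
  Rejects P v = (v ≡ 0 → P) × (v ≢ 0 → ¬ P)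

  flag⇒rejects : ∀ {P v} → Flag P v → Rejects P (1 ∸ v)
  flag⇒rejects {v = zero}  (holds v≢0 _) = contradiction refl v≢0
  flag⇒rejects {v = suc v} (holds _ p)   =
    (λ _ → p) , λ ≢0 → contradiction (0∸n≡0 v) ≢0
  flag⇒rejects (fails refl ¬p) = (λ ()) , λ _ → ¬p

  Complemented : Formula 1 → ℕ → (ℕ → ℕ) → Set
  Complemented φ c M = ∀ y → c ≤ toℕ y → Rejects (y ∷ [] ⊨ φ) (M (n * n + toℕ y))

  storeComplement-correct : ∀ φ x {s} →
    Ready (x ∷ []) s → Complemented φ (suc (toℕ x)) (mem s) →
    Runs (storeComplement φ) s (time φ n + 3)
      (λ s′ → Ready (x ∷ []) s′ × Complemented φ (toℕ x) (mem s′))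
  storeComplement-correct φ x {s} r later = runs-seq (compile-correct φ r) finish
    where
    finish : ∀ {s′} → Decided (x ∷ []) (x ∷ [] ⊨ φ) (mem s) s′ →
      Runs (sub result one result ⨾ add (col 1) area (col 0) ⨾ store (col 1) result) s′ 3
        (λ s″ → Ready (x ∷ []) s″ × Complemented φ (toℕ x) (mem s″))
    finish {s′} (decided r′ refl f) = sub ▸ add ▸ runs store ≤-refl
      (subst (λ a → Post (setMem s₂ a (reg s₂ result))) (sym address)
        (ready-store (toℕ x) (ready-fresh ≤-refl (ready-result r′)) , ∀-≥ here there))
      where
      Post : State → Set
      Post s″ = Ready (x ∷ []) s″ × Complemented φ (toℕ x) (mem s″)

      s₁ s₂ : State
      s₁ = setReg s′ result (reg s′ one ∸ reg s′ result)
      s₂ = setReg s₁ (col 1) (reg s₁ area + reg s₁ (col 0))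

      address : reg s₂ (col 1) ≡ n * n + toℕ x
      address = cong₂ _+_ (area-reg r′) (col-reg r′ zero)

      M = mem s′ [ n * n + toℕ x ↦ reg s₂ result ]

      here : Rejects (x ∷ [] ⊨ φ) (M (n * n + toℕ x))
      here = subst (Rejects _)
        (sym (trans (update-same (mem s′) _ _) (cong (_∸ reg s′ result) (one-reg r′))))
        (flag⇒rejects f)

      there : ∀ y → toℕ x < toℕ y → Rejects (y ∷ [] ⊨ φ) (M (n * n + toℕ y))
      there y x<y = subst (Rejects _)
        (sym (update-other (mem s′) _ (>⇒≢ (+-monoʳ-< (n * n) x<y)))) (later y x<y)

  complement-correct : ∀ φ →
    Runs (complement φ) (input G E?) (complementTime φ n) (Complemented φ 0 ∘ mem)
  complement-correct φ =
    const ▸ runs-seq (computeArea-correct refl refl refl matrix-adjacency) λ r →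
      runs-map proj₂
        (runs-forEach (λ c _ → Complemented φ c) (storeComplement-correct φ) r
          (λ y n≤y → contradiction n≤y (<⇒≱ (toℕ<n y))))

-- The algorithm for R-cocores

T-nonzero : ∀ {v} → T (not (v ≡ᵇ 0)) → v ≢ 0
T-nonzero {suc v} _ ()

¬T-nonzero : ∀ {v} → ¬ T (not (v ≡ᵇ 0)) → v ≡ 0
¬T-nonzero {zero}  _ = refl
¬T-nonzero {suc v} h = contradiction _ h

mainTheorem10 : ∃ λ (p : Program) → ∃ λ (c : ℕ) → ∃ λ (k : ℕ) →
    ∀ (n : ℕ) (G : Graph (Fin n)) (E? : Decidable (Edge G)) →
    ∃ λ (s : State) → ∃ λ (t : ℕ) →
    (p , input G E? ⇓ s after t) ×
    (t ≤ c * n ^ k + c) ×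
    IsRCocore G (output n s)
mainTheorem10 =
  let c , k , time≤ = poly⇒≤c*n^k+c (complementTime-poly coveredᶠ)
  in complement coveredᶠ , c , k , λ n G E? →
    let open ComplementCorrect G E?
        runs {s} {t} d t≤ correct = complement-correct coveredᶠ
    in s , t , d , ≤-trans t≤ (time≤ n) ,
       Neighbourhoods.isRCocore G (output n s)
         (λ v v∉S → proj₁ (correct v z≤n) (¬T-nonzero v∉S))
         (λ v v∈S → proj₂ (correct v z≤n) (T-nonzero v∈S))
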